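{- Let $F$ be a causal dynamics from $\mathcal{G}_{\Sigma,\Delta,\pi}$ to $\mathcal{G}_{\Sigma,\Delta,\pi}$, with $\Sigma$ and $\Delta$ finite. If $F$ is invertible with inverse dynamics $F^\dagger$, then $F^\dagger$ is also causal.
   Context: **Graphs.** Fix an uncountable infinite set $V$ of names, sets of states $\Sigma,\Delta$, and a natural number $\pi$ (the degree). A graph $G$ consists of: an at most countable (possibly infinite) subset $V(G)\subseteq V$ of vertices; the set of ports $1..\pi=\{1,\dots,\pi\}$; a partial function $\sigma_G$ from $V(G)$ to $\Sigma$; and a partial function $\delta_G$ from $(V(G)\times 1..\pi)\times(V(G)\times 1..\pi)$ to $\Delta$ such that each $u\!:\!i:=(u,i)$ appears at most once in $\mathrm{dom}(\delta_G)$. The set of all graphs is $\mathcal{G}_{\Sigma,\Delta,\pi}$; $v\in G$ means $v\in V(G)$. A pointed graph is a pair $(G,A)$ with $A\subseteq V(G)$ (the pointer set). **Isomorphisms.** An isomorphism $R$ is a map $\mathcal{G}_{\Sigma,\Delta,\pi}\to\mathcal{G}_{\Sigma,\Delta,\pi}$ specified by a bijection $R(\cdot):V\to V$: $RG$ has vertex set $R(V(G))$, $\sigma_{RG}=\sigma_G\circ R^{ -1}$, $\delta_{RG}=\delta_G\circ R^{ -1}$ (with $R^{ -1}(u\!:\!i)=R^{ -1}(u)\!:\!i$). **Dynamics.** A dynamics is a function $F:\mathcal{G}_{\Sigma,\Delta,\pi}\to\mathcal{G}_{\Sigma,\Delta,\pi}$ such that (i) for every isomorphism $R$ there is an isomorphism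 $R'$ with $F(RG)=R'F(G)$ for all $G$; (ii) for every family of graphs $(G^{(i)})$, if $\bigcap V(G^{(i)})=\emptyset$ then $\bigcap V(F(G^{(i)}))=\emptyset$. A dynamics $F$ is invertible if there exists a dynamics $F^\dagger$ (its inverse) with $F^\dagger\circ F=\mathrm{Id}$ and $F\circ F^\dagger=\mathrm{Id}$. **Disks.** Write $u\frown v$ (in $G$) if there are ports $i,j$ such that $\delta_G(u\!:\!i,v\!:\!j)$ or $\delta_G(v\!:\!j,u\!:\!i)$ is defined; $u\frown^k v$ if there is a chain $u\frown w_1\frown\dots\frown w_{k-1}\frown v$ (with $u\frown^0 v$ iff $u=v$); $u\frown^{\le r}v$ if $u\frown^k v$ for some $k\le r$. The neighbours of radius $r$ of a set $A$ w.r.t. $G$ are the $v\in V(G)$ with $u\frown^{\le r}v$ for some $u\in A$. The induced subgraph $G_U$ of $G$ around a set $U$ has as vertices the neighbours of radius one of $U'=V(G)\cap U$, has $\sigma_{G_U}$ the restriction of $\sigma_G$ to $U'$, and $\delta_{G_U}$ the restriction of $\delta_G$ to $\big((V(G_U)\times 1..\pi)\times(U'\times 1..\pi)\big)\cup\big((U'\times 1..\pi)\times(V(G_U)\times 1..\pi)\big)$. Write $G_v$ for $G_{\{v\}}$. The envelope $G^r_A$ of radius $r$ of a set $A$ is the pointed graph whose graph is the induced subgraph of $G$ around the neighbours of radius $r$ of $A$ and whose pointer set is $A$; write $G^r_v$ for $G^r_{\{v\}}$. (If $v\notin V(G)$, the underlying graphs of $G_v$ and $G^r_v$ are empty.) **Antecedents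 and causality.** The antecedent codynamics of a dynamics $F$ is the map $a$ from $V$ to subsets of $V$ with $v\in a(v')$ iff for all $G$, $[v'\in F(G)\Rightarrow v\in G]$. $F$ is causal if there exist a radius $r$ and a bound $b$ such that (i) for all $v'$, all $v\in a(v')$ and all graphs $G,H$: $G^r_v=H^r_v\Rightarrow F(G)_{v'}=F(H)_{v'}$; (ii) for all $G$ and all $v\in G$: $|\{v'\in F(G) : v\in a(v')\}|\le b$. -}

module Defs where

open import Level using (Level; 0ℓ) renaming (suc to lsuc)
open import Data.Fin.Base using (Fin)
open import Data.Nat.Base using (ℕ; zero; suc; _≤_; z≤n)
open import Data.Product.Base using (∃; ∃-syntax; _×_; _,_; proj₁; proj₂; map₂)
open import Data.Sum.Base using (_⊎_; [_,_]′)
open import Function.Base using (_∘_)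
open import Function.Bundles using (Func; _↔_; Inverse)
open import Relation.Binary.Bundles using (Setoid)
open import Relation.Binary.PropositionalEquality using (_≡_; refl; sym; trans; cong; cong₂)
open import Relation.Nullary.Negation using (¬_)
open import Relation.Unary using (Pred; _∈_; _⊆_; _≐_; _∩_; ⋂; Empty; U; ｛_｝)
open import Relation.Unary.Properties using (≐-refl; ≐-sym; ≐-trans)

private variable
  a ℓ : Level
  A : Set a

Finite : Set a → Set a
Finite A = ∃[ n ] (A ↔ Fin n)

-- The subset P has at most as many elements as T.  The injection acts on pairs
-- of an element and a membership proof, but its values separate elements, so
-- multiple proofs of the same membership do not affect the cardinality.
_≼_ : Pred A ℓ → Set → Set _
P ≼ T = ∃ λ (f : ∀ {x} → x ∈ P → T) →
          ∀ {x y} (p : x ∈ P) (q : y ∈ P) → f p ≡ f q → x ≡ y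

AtMostCountable : Pred A ℓ → Set _
AtMostCountable P = P ≼ ℕ

Uncountable : Set a → Set a
Uncountable A = ¬ AtMostCountable (U {A = A})

module GraphDynamics (V Σ Δ : Set) (π : ℕ) where

  Port : Set
  Port = V × Fin π

  -- The partial functions σ and δ are given by their graphs, that is, as
  -- single-valued relations; restricting them then needs no decision procedure.
  record Graph : Set₁ where
    field
      vertices  : Pred V 0ℓ
      countable : AtMostCountable vertices

      σ            : Pred (V × Σ) 0ℓ
      σ-dom        : ∀ {v s} → (v , s) ∈ σ → v ∈ vertices
      σ-functional : ∀ {v s t} → (v , s) ∈ σ → (v , t) ∈ σ → s ≡ t

      δ            : Pred (Port × Port × Δ) 0ℓ
      δ-dom        : ∀ {u i v j d} → ((u , i) , (v , j) , d) ∈ δ →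
                     u ∈ vertices × v ∈ vertices
      δ-functional : ∀ {p q d e} → (p , q , d) ∈ δ → (p , q , e) ∈ δ → d ≡ e

      -- Each port occurs at most once in dom δ: not in two pairs on the same
      -- side, and not both as a first and as a second component (so in
      -- particular a port is not linked to itself).
      δ-onceˡ  : ∀ {p q q′ d e} → (p , q , d) ∈ δ → (p , q′ , e) ∈ δ → q ≡ q′
      δ-onceʳ  : ∀ {p p′ q d e} → (p , q , d) ∈ δ → (p′ , q , e) ∈ δ → p ≡ p′
      δ-onceˡʳ : ∀ {p q q′ d e} → (p , q , d) ∈ δ → ¬ ((q′ , p , e) ∈ δ)

  open Graph

  infix 4 _≈_

  -- Set-theoretic equality of graphs; the proofs carried by them are ignored.
  record _≈_ (G H : Graph) : Set where
    field
      vertices-≐ : vertices G ≐ vertices H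
      σ-≐        : σ G ≐ σ H
      δ-≐        : δ G ≐ δ H

  open _≈_

  𝒢 : Setoid (lsuc 0ℓ) 0ℓ
  𝒢 = record
    { Carrier = Graph
    ; _≈_ = _≈_
    ; isEquivalence = record
      { refl  = record { vertices-≐ = ≐-refl ; σ-≐ = ≐-refl ; δ-≐ = ≐-refl }
      ; sym   = λ e → record
        { vertices-≐ = ≐-sym (vertices-≐ e)
        ; σ-≐ = ≐-sym (σ-≐ e)
        ; δ-≐ = ≐-sym (δ-≐ e) }
      ; trans = λ e f → record
        { vertices-≐ = ≐-trans (vertices-≐ e) (vertices-≐ f)
        ; σ-≐ = ≐-trans (σ-≐ e) (σ-≐ f)
        ; δ-≐ = ≐-trans (δ-≐ e) (δ-≐ f) }
      }
    }

  module _ (R : V ↔ V) where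
    open Inverse R using (from; strictlyInverseˡ) renaming (to to R·)

    private
      from-injective : ∀ {u v} → from u ≡ from v → u ≡ v
      from-injective {u} {v} e =
        trans (sym (strictlyInverseˡ u)) (trans (cong R· e) (strictlyInverseˡ v))

      fromᵖ : Port → Port
      fromᵖ (u , i) = from u , i

      fromᵖ-injective : ∀ {p q} → fromᵖ p ≡ fromᵖ q → p ≡ q
      fromᵖ-injective e = cong₂ _,_ (from-injective (cong proj₁ e)) (cong proj₂ e)

    rename : Graph → Graph
    rename G = record
      { vertices     = λ v → from v ∈ vertices G
      ; countable    = proj₁ (countable G) ,
                       λ p q e → from-injective (proj₂ (countable G) p q e)
      ; σ            = λ (v , s) → (from v , s) ∈ σ G
      ; σ-dom        = σ-dom G
      ; σ-functional = σ-functional G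
      ; δ            = λ (p , q , d) → (fromᵖ p , fromᵖ q , d) ∈ δ G
      ; δ-dom        = δ-dom G
      ; δ-functional = δ-functional G
      ; δ-onceˡ      = λ x y → fromᵖ-injective (δ-onceˡ G x y)
      ; δ-onceʳ      = λ x y → fromᵖ-injective (δ-onceʳ G x y)
      ; δ-onceˡʳ     = δ-onceˡʳ G
      }

  record Dynamics : Set₂ where
    field
      func : Func 𝒢 𝒢

    open Func func public using () renaming (to to apply; cong to apply-cong)

    field
      -- An isomorphism is given by the bijection of names specifying it.
      renaming-compatible : ∀ (R : V ↔ V) →
        ∃[ R′ ] (∀ G → apply (rename R G) ≈ rename R′ (apply G))

      -- Graph itself is in Set₁, so index types in Set₁ cover every set of graphs.
      no-creation : ∀ {I : Set₁} (G : I → Graph) →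
        Empty (⋂ I (λ i → vertices (G i))) →
        Empty (⋂ I (λ i → vertices (apply (G i))))

  infixr 20 _·_

  _·_ : Dynamics → Graph → Graph
  F · G = Dynamics.apply F G

  infix 4 _IsInverseOf_

  _IsInverseOf_ : Dynamics → Dynamics → Set₁
  F† IsInverseOf F = (∀ G → F† · F · G ≈ G) × (∀ G → F · F† · G ≈ G)

  infix 4 _⊢_⌢_ _⊢_⌢[_]_ _⊢_⌢[≤_]_

  _⊢_⌢_ : Graph → V → V → Set
  G ⊢ u ⌢ v = ∃[ i ] ∃[ j ] ∃[ d ]
    (((u , i) , (v , j) , d) ∈ δ G ⊎ ((v , j) , (u , i) , d) ∈ δ G)

  _⊢_⌢[_]_ : Graph → V → ℕ → V → Set
  G ⊢ u ⌢[ zero  ] v = u ≡ v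
  G ⊢ u ⌢[ suc k ] v = ∃[ w ] (G ⊢ u ⌢ w × G ⊢ w ⌢[ k ] v)

  _⊢_⌢[≤_]_ : Graph → V → ℕ → V → Set
  G ⊢ u ⌢[≤ r ] v = ∃[ k ] (k ≤ r × G ⊢ u ⌢[ k ] v)

  neighbours : Graph → ℕ → Pred V 0ℓ → Pred V 0ℓ
  neighbours G r A v = v ∈ vertices G × ∃[ u ] (u ∈ A × G ⊢ u ⌢[≤ r ] v)

  module _ (G : Graph) (W : Pred V 0ℓ) where

    private
      W′ N : Pred V 0ℓ
      W′ = vertices G ∩ W
      N  = neighbours G 1 W′

      W′⊆N : W′ ⊆ N
      W′⊆N {v} w = proj₁ w , v , w , 0 , z≤n , refl

    induced : Graph
    induced = record
      { vertices     = N
      ; countable    = (λ n → proj₁ (countable G) (proj₁ n)) ,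
                       λ m n → proj₂ (countable G) (proj₁ m) (proj₁ n)
      ; σ            = λ (v , s) → v ∈ W′ × (v , s) ∈ σ G
      ; σ-dom        = λ (w , _) → W′⊆N w
      ; σ-functional = λ (_ , x) (_ , y) → σ-functional G x y
      ; δ            = λ (p , q , d) →
          ((proj₁ p ∈ N × proj₁ q ∈ W′) ⊎ (proj₁ p ∈ W′ × proj₁ q ∈ N)) ×
          (p , q , d) ∈ δ G
      ; δ-dom        = λ (x , _) → [ map₂ W′⊆N , (λ (w , n) → W′⊆N w , n) ]′ x
      ; δ-functional = λ (_ , x) (_ , y) → δ-functional G x y
      ; δ-onceˡ      = λ (_ , x) (_ , y) → δ-onceˡ G x y
      ; δ-onceʳ      = λ (_ , x) (_ , y) → δ-onceʳ G x y
      ; δ-onceˡʳ     = λ (_ , x) (_ , y) → δ-onceˡʳ G x y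
      }

  star : Graph → V → Graph
  star G v = induced G ｛ v ｝

  -- The pointers are not required to be vertices, because the envelope of v
  -- in G is considered also when v is not a vertex of G.
  record PointedGraph : Set₁ where
    constructor _at_
    field
      graph    : Graph
      pointers : Pred V 0ℓ

  infix 4 _≈•_

  _≈•_ : PointedGraph → PointedGraph → Set
  (G at A) ≈• (H at B) = G ≈ H × A ≐ B

  envelope : Graph → ℕ → Pred V 0ℓ → PointedGraph
  envelope G r A = induced G (neighbours G r A) at A

  antecedents : Dynamics → V → Pred V (lsuc 0ℓ)
  antecedents F v′ v = ∀ G → v′ ∈ vertices (F · G) → v ∈ vertices G

  record CausalWith (F : Dynamics) (r b : ℕ) : Set₁ where
    field
      local : ∀ v′ {v} → v ∈ antecedents F v′ → ∀ G H →
        envelope G r ｛ v ｝ ≈• envelope H r ｛ v ｝ →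
        star (F · G) v′ ≈ star (F · H) v′

      bounded : ∀ G {v} → v ∈ vertices G →
        (λ v′ → v′ ∈ vertices (F · G) × v ∈ antecedents F v′) ≼ Fin b

  Causal : Dynamics → Set₁
  Causal F = ∃[ r ] ∃[ b ] CausalWith F r b

module Submission where

open import Defs
open import Level using (0ℓ; suc; lift; lower)
open import Data.Empty using (⊥; ⊥-elim)
open import Data.Fin.Base as Fin using (Fin; toℕ; fromℕ<)
open import Data.Fin.Properties using (toℕ-injective; toℕ-fromℕ<)
open import Data.List.Base using (List; []; _∷_)
open import Data.Nat.Base as ℕ using (ℕ; zero; _≤′_; ≤′-refl; ≤′-step; _*_; _⊔_; _≤_; _<_; z≤n; s≤s)
open import Data.Nat.Induction using (<-rec)
open import Data.Nat.Properties
  using (even≢odd; *-cancelˡ-≡; suc-injective; ≤-refl; ≤-trans; ≤-antisym; ≤⇒≤′; <⇒≤;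
         m≤m⊔n; m≤n⊔m; ≮⇒≥; <-cmp)
open import Data.Product.Base using (∃; ∃-syntax; _×_; _,_; proj₁; proj₂; map₂; swap)
open import Data.Sum.Base as Sum using (_⊎_; inj₁; inj₂; [_,_]′)
open import Data.Unit.Base using (tt)
open import Function.Base using (_∘_; id; const)
open import Function.Bundles using (_↔_; mk↔ₛ′; Inverse)
open import Function.Definitions using (Injective)
open import Function.Construct.Symmetry using (↔-sym)
open import Relation.Binary.Bundles using (Setoid)
open import Relation.Binary.Definitions using (tri<; tri≈; tri>)
open import Relation.Binary.PropositionalEquality
  using (_≡_; refl; sym; trans; cong; cong₂; subst)
open import Relation.Nullary.Decidable using (Dec; yes; no; map′; decidable-stable)
open import Relation.Nullary.Negation using (¬_; contradiction)
open import Relation.Unary using (Pred; _∈_; _∉_; _⊆_; _∩_; _∪_; _≐_; ∁; U; ｛_｝)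
open import Axiom.ExcludedMiddle using (ExcludedMiddle)

-- F and F† create nothing ex nihilo, so every v has a w with v ∈ G ⇒ w ∈ F G,
-- and w has an antecedent, which must be v itself.  Hence, up to a bijection of
-- names, F preserves vertices and commutes with renamings, and a causal F is a
-- local bijection T.  If S is closed under adjacency in K, then T maps the
-- disjoint union of T⁻¹ of the two parts of K to K, so T⁻¹ K on S depends only on
-- K on S.  Were T⁻¹ not local, there would be for each n graphs P, Q differing at
-- a vertex v such that T P, T Q agree on the ball of radius n around v.  By
-- compactness (Σ, Δ and the degree are finite) these pairs have a limit, in which
-- P, Q still differ at v whereas T P, T Q agree on the whole component of v:
-- a contradiction.

private variable
  A B : Set

-- Codes in ℕ

-- This is 2^m (2n + 1) - 1, so parity alone decides at each stage whether the first component is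
-- zero.
pair : ℕ → ℕ → ℕ
pair zero      n = 2 * n
pair (ℕ.suc m) n = ℕ.suc (2 * pair m n)

pair-injective : ∀ m m′ {n n′} → pair m n ≡ pair m′ n′ → m ≡ m′ × n ≡ n′
pair-injective zero zero e = refl , *-cancelˡ-≡ _ _ 2 e
pair-injective zero (ℕ.suc m′) {n} {n′} e = contradiction e (even≢odd n (pair m′ n′))
pair-injective (ℕ.suc m) zero {n} {n′} e = contradiction (sym e) (even≢odd n′ (pair m n))
pair-injective (ℕ.suc m) (ℕ.suc m′) e =
  let p , q = pair-injective m m′ (*-cancelˡ-≡ _ _ 2 (suc-injective e))
  in cong ℕ.suc p , q

module _ (c : A → ℕ) where

  code-list : List A → ℕ
  code-list []       = 0
  code-list (a ∷ as) = ℕ.suc (pair (c a) (code-list as))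

  code-list-injective : Injective _≡_ _≡_ c → Injective _≡_ _≡_ code-list
  code-list-injective inj {[]}     {[]}     _ = refl
  code-list-injective inj {a ∷ as} {b ∷ bs} e =
    let p , q = pair-injective (c a) (c b) (suc-injective e)
    in cong₂ _∷_ (inj p) (code-list-injective inj q)

code-⊎ : (A → ℕ) → (B → ℕ) → A ⊎ B → ℕ
code-⊎ c d (inj₁ a) = pair 0 (c a)
code-⊎ c d (inj₂ b) = pair 1 (d b)

code-⊎-injective : ∀ {c : A → ℕ} {d : B → ℕ} → Injective _≡_ _≡_ c →
                   Injective _≡_ _≡_ d → Injective _≡_ _≡_ (code-⊎ c d)
code-⊎-injective {c = c} inj inj′ {inj₁ a} {inj₁ b} e =
  cong inj₁ (inj (proj₂ (pair-injective 0 0 {c a} {c b} e)))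
code-⊎-injective {d = d} inj inj′ {inj₂ a} {inj₂ b} e =
  cong inj₂ (inj′ (proj₂ (pair-injective 1 1 {d a} {d b} e)))
code-⊎-injective {c = c} {d} inj inj′ {inj₁ a} {inj₂ b} e =
  contradiction (proj₁ (pair-injective 0 1 {c a} {d b} e)) λ ()
code-⊎-injective {c = c} {d} inj inj′ {inj₂ a} {inj₁ b} e =
  contradiction (proj₁ (pair-injective 1 0 {d a} {c b} e)) λ ()

code-finite : Finite A → A → ℕ
code-finite (_ , i) a = toℕ (Inverse.to i a)

code-finite-injective : (fin : Finite A) → Injective _≡_ _≡_ (code-finite fin)
code-finite-injective (_ , i) {a} {b} e =
  trans (sym (Inverse.strictlyInverseʳ i a))
        (trans (cong (Inverse.from i) (toℕ-injective e)) (Inverse.strictlyInverseʳ i b))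

-- Filters deciding countably many properties

-- A proper filter on ℕ containing all tails. Together with `Decides` for a countable family of
-- properties it serves as a nonprincipal ultrafilter for that family.
record Filter : Set₁ where
  field
    Eventually : Pred ℕ 0ℓ → Set
    ev-map     : ∀ {Φ Ψ} → Φ ⊆ Ψ → Eventually Φ → Eventually Ψ
    ev-×       : ∀ {Φ Ψ} → Eventually Φ → Eventually Ψ → Eventually (Φ ∩ Ψ)
    ev-≥       : ∀ k → Eventually (k ≤_)
    ev-∃       : ∀ {Φ} → Eventually Φ → ∃ Φ

  ev-∀Fin : ∀ k {Φ : Fin k → Pred ℕ 0ℓ} → (∀ i → Eventually (Φ i)) →
            Eventually (λ n → ∀ i → Φ i n)
  ev-∀Fin zero    h = ev-map (λ _ ()) (ev-≥ 0)
  ev-∀Fin (ℕ.suc k) h =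
    ev-map (λ { (p , q) Fin.zero → p ; (p , q) (Fin.suc i) → q i })
           (ev-× (h Fin.zero) (ev-∀Fin k (h ∘ Fin.suc)))

  ev-∀ : Finite A → {Φ : A → Pred ℕ 0ℓ} → (∀ a → Eventually (Φ a)) →
         Eventually (λ n → ∀ a → Φ a n)
  ev-∀ (k , i) {Φ} h =
    ev-map (λ {n} p a → subst (λ a → Φ a n) (Inverse.strictlyInverseʳ i a) (p (Inverse.to i a)))
           (ev-∀Fin k (h ∘ Inverse.from i))

  ev-∀< : ∀ k {Φ : ℕ → Pred ℕ 0ℓ} → (∀ m → Eventually (Φ m)) →
          Eventually (λ n → ∀ {m} → m < k → Φ m n)
  ev-∀< k {Φ} h =
    ev-map (λ {n} p {m} m<k → subst (λ m → Φ m n) (toℕ-fromℕ< m<k) (p (fromℕ< m<k)))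
           (ev-∀Fin k (h ∘ toℕ))

open Filter

Decides : Filter → Pred ℕ 0ℓ → Set
Decides 𝓕 Φ = Eventually 𝓕 Φ ⊎ Eventually 𝓕 (∁ Φ)

-- Countable sets of names

module _ {V : Set} where

  countable-⋃ : {P : ℕ → Pred V 0ℓ} → (∀ n → AtMostCountable (P n)) →
                AtMostCountable (λ x → ∃[ n ] P n x)
  countable-⋃ c = (λ (n , p) → pair n (proj₁ (c n) p)) , inj
    where
    inj : ∀ {x y} p q → _ → x ≡ y
    inj (n , p) (m , q) e with pair-injective n m e
    ... | refl , eq = proj₂ (c n) p q eq

  countable-∪ : {P Q : Pred V 0ℓ} → AtMostCountable P → AtMostCountable Q → AtMostCountable (P ∪ Q)
  countable-∪ (f , f-inj) (g , g-inj) = [ (λ p → pair 0 (f p)) , (λ q → pair 1 (g q)) ]′ , inj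
    where
    inj : ∀ {x y} p q → _ → x ≡ y
    inj (inj₁ p) (inj₁ q) e = f-inj p q (proj₂ (pair-injective 0 0 e))
    inj (inj₂ p) (inj₂ q) e = g-inj p q (proj₂ (pair-injective 1 1 e))
    inj (inj₁ p) (inj₂ q) e = contradiction (proj₁ (pair-injective 0 1 {f p} {g q} e)) λ ()
    inj (inj₂ p) (inj₁ q) e = contradiction (proj₁ (pair-injective 1 0 {g p} {f q} e)) λ ()

  countable-｛｝ : (x : V) → AtMostCountable ｛ x ｝
  countable-｛｝ x = (λ _ → 0) , λ p q _ → trans (sym p) q

-- Deciding filters from excluded middle

module Classical (em : ExcludedMiddle (suc 0ℓ)) where

  em₀ : ExcludedMiddle 0ℓ
  em₀ = map′ lower lift em

  least : (P : Pred ℕ 0ℓ) → ∀ {n} → P n → ∃[ m ] (P m × ∀ {k} → P k → m ≤ k)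
  least P {n} = <-rec (λ n → P n → ∃[ m ] (P m × ∀ {k} → P k → m ≤ k)) step n
    where
    step : ∀ n → (∀ {m} → m < n → P m → ∃[ m ] (P m × ∀ {k} → P k → m ≤ k)) →
           P n → ∃[ m ] (P m × ∀ {k} → P k → m ≤ k)
    step n ih p with em₀ {∃[ m ] (m < n × P m)}
    ... | yes (m , m<n , q) = ih m<n q
    ... | no ∄ = n , p , λ q → ≮⇒≥ λ k<n → ∄ (_ , k<n , q)

  -- Bolzano–Weierstrass: intersecting successively with Φ 0, Φ 1, … or with
  -- their complements keeps an infinite set of indices.
  module _ (Φ : ℕ → Pred ℕ 0ℓ) where

    private
      Infinite : Pred ℕ 0ℓ → Set
      Infinite S = ∀ N → ∃[ n ] (N ≤ n × S n)

      infinite-split : ∀ {S} c → Infinite S → Infinite (S ∩ Φ c) ⊎ Infinite (S ∩ ∁ (Φ c))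
      infinite-split {S} c inf with em₀ {Infinite (S ∩ Φ c)}
      ... | yes inf∩ = inj₁ inf∩
      ... | no ¬inf = inj₂ λ N → decidable-stable em₀ λ ∄ →
        -- If no member of `S` from `N` on misses `Φ c`, then any member beyond both `N` and `M`
        -- satisfies it, and `S ∩ Φ c` is infinite after all.
        ¬inf λ M → let n , le , s = inf (N ⊔ M) in
          n , ≤-trans (m≤n⊔m N M) le , s ,
          decidable-stable em₀ (λ ¬φ → ∄ (n , ≤-trans (m≤m⊔n N M) le , s , ¬φ))

      stage : ℕ → ∃ Infinite
      stage zero = U , λ N → N , ≤-refl , tt
      stage (ℕ.suc c) =
        [ (λ i → proj₁ (stage c) ∩ Φ c , i) , (λ i → proj₁ (stage c) ∩ ∁ (Φ c) , i) ]′
        (infinite-split c (proj₂ (stage c)))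

      Stage : ℕ → Pred ℕ 0ℓ
      Stage c = proj₁ (stage c)

      stage-step : ∀ c → Stage (ℕ.suc c) ⊆ Stage c
      stage-step c with infinite-split c (proj₂ (stage c))
      ... | inj₁ _ = proj₁
      ... | inj₂ _ = proj₁

      stage-decides : ∀ c → (∀ n → Stage (ℕ.suc c) n → Φ c n) ⊎ (∀ n → Stage (ℕ.suc c) n → ¬ Φ c n)
      stage-decides c with infinite-split c (proj₂ (stage c))
      ... | inj₁ _ = inj₁ λ _ → proj₂
      ... | inj₂ _ = inj₂ λ _ → proj₂

      stage-antitone : ∀ {c d} → c ≤′ d → Stage d ⊆ Stage c
      stage-antitone ≤′-refl      = id
      stage-antitone (≤′-step le) = stage-antitone le ∘ stage-step _

    -- The tails of the stages are a filter base because the stages decrease. It is proper because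
    -- every stage is infinite, and stage `c + 1` settles `Φ c`.
    limit-filter : ∃[ 𝓕 ] (∀ c → Decides 𝓕 (Φ c))
    limit-filter = 𝓕 , λ c →
      [ (λ h → inj₁ (ℕ.suc c , 0 , λ {n} _ → h n)) , (λ h → inj₂ (ℕ.suc c , 0 , λ {n} _ → h n)) ]′
      (stage-decides c)
      where
      𝓕 : Filter
      𝓕 .Eventually Ψ = ∃[ c ] ∃[ N ] (∀ {n} → N ≤ n → Stage c n → Ψ n)
      𝓕 .ev-map f (c , N , h) = c , N , λ le s → f (h le s)
      𝓕 .ev-× (c , N , h) (d , M , k) = c ⊔ d , N ⊔ M , λ le s →
        h (≤-trans (m≤m⊔n N M) le) (stage-antitone (≤⇒≤′ (m≤m⊔n c d)) s) ,
        k (≤-trans (m≤n⊔m N M) le) (stage-antitone (≤⇒≤′ (m≤n⊔m c d)) s)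
      𝓕 .ev-≥ k = 0 , k , λ le _ → le
      𝓕 .ev-∃ (c , N , h) = let n , le , s = proj₂ (stage c) N in n , h le s

  deciding-filter : (code : A → ℕ) → Injective _≡_ _≡_ code → (Φ : A → Pred ℕ 0ℓ) →
                    ∃[ 𝓕 ] (∀ a → Decides 𝓕 (Φ a))
  deciding-filter code inj Φ = 𝓕 , decides
    where
    -- The index type is only injected into ℕ; at a number that codes nothing the property is false.
    limit = limit-filter (λ c n → ∃[ a ] (code a ≡ c × Φ a n))
    𝓕 = proj₁ limit
    decides : ∀ a → Decides 𝓕 (Φ a)
    decides a with proj₂ limit (code a)
    ... | inj₁ e = inj₁ (ev-map 𝓕 (λ {n} (b , eq , φ) → subst (λ a → Φ a n) (inj eq) φ) e)
    ... | inj₂ e = inj₂ (ev-map 𝓕 (λ ∄ φ → ∄ (a , refl , φ)) e)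

  -- Fresh names

  module Fresh {V : Set} (uncountable : Uncountable V) {C : Pred V 0ℓ} (countable : AtMostCountable C) where

    private
      fresh : {P : Pred V 0ℓ} → AtMostCountable P → ∃ (∁ P)
      fresh {P} (f , f-inj) = decidable-stable em₀ λ ∄ →
        let p = λ x → decidable-stable em₀ (λ ¬p → ∄ (x , ¬p)) in
        uncountable ((λ {x} _ → f (p x)) , λ {x} {y} _ _ → f-inj (p x) (p y))

      -- Stage `n` is `C` with the names `ι 0`, ..., `ι (n - 1)` added. It stays countable, so a
      -- further name can always be chosen outside it.
      used : ℕ → ∃ AtMostCountable
      used zero    = C , countable
      used (ℕ.suc n) = let P , c = used n in
        (P ∪ ｛ proj₁ (fresh c) ｝) , countable-∪ {Q = ｛ proj₁ (fresh c) ｝} c (countable-｛｝ _)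

    ι : ℕ → V
    ι n = proj₁ (fresh (proj₂ (used n)))

    private
      ι-new : ∀ n → ι n ∉ proj₁ (used n)
      ι-new n = proj₂ (fresh (proj₂ (used n)))

      used-mono : ∀ {m n} → m ≤′ n → proj₁ (used m) ⊆ proj₁ (used n)
      used-mono ≤′-refl = id
      used-mono (≤′-step le) = inj₁ ∘ used-mono le

      ι-distinct : ∀ {m n} → m < n → ι m ≡ ι n → A
      ι-distinct {n = n} m<n e = contradiction (used-mono {n = n} (≤⇒≤′ m<n) (inj₂ e)) (ι-new n)

    ι-avoids : ∀ n → ι n ∉ C
    ι-avoids n = ι-new n ∘ used-mono {n = n} (≤⇒≤′ z≤n)

    ι-injective : Injective _≡_ _≡_ ι
    ι-injective {m} {n} e with <-cmp m n
    ... | tri< m<n _ _ = ι-distinct m<n e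
    ... | tri≈ _ m≡n _ = m≡n
    ... | tri> _ _ n<m = ι-distinct n<m (sym e)

-- Locality in terms of agreement of graphs

module Graphs (V Σ Δ : Set) (π : ℕ) where

  open GraphDynamics V Σ Δ π public
  open Graph public
  open _≈_ public

  -- The atomic statements that make up a graph. Over `V` they are read by `_⊨_`; over ℕ there are
  -- countably many of them, and `ι` turns them into statements about named vertices.
  data Fact (X : Set) : Set where
    vertex : X → Fact X
    label  : X → Σ → Fact X
    edge   : X → Fin π → X → Fin π → Δ → Fact X

  data _about_ {X : Set} : Fact X → X → Set where
    vertex : ∀ {v} → vertex v about v
    label  : ∀ {v s} → label v s about v
    source : ∀ {u i v j d} → edge u i v j d about u
    target : ∀ {u i v j d} → edge u i v j d about v

  map-fact : ∀ {X Y} → (X → Y) → Fact X → Fact Y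
  map-fact f (vertex v)       = vertex (f v)
  map-fact f (label v s)      = label (f v) s
  map-fact f (edge u i v j d) = edge (f u) i (f v) j d

  about-map : ∀ {X Y} (f : X → Y) {φ v} → φ about v → map-fact f φ about f v
  about-map f vertex = vertex
  about-map f label  = label
  about-map f source = source
  about-map f target = target

  module _ (c : Σ → ℕ) (d : Δ → ℕ) where

    private
      tag : ∀ {X} → Fact X → ℕ
      tag (vertex _)       = 0
      tag (label _ _)      = 1
      tag (edge _ _ _ _ _) = 2

      content : Fact ℕ → ℕ
      content (vertex m)        = m
      content (label m s)       = pair m (c s)
      content (edge m i n j x)  = pair m (pair (toℕ i) (pair n (pair (toℕ j) (d x))))

    code-fact : Fact ℕ → ℕ
    code-fact φ = pair (tag φ) (content φ)

    code-fact-injective : Injective _≡_ _≡_ c → Injective _≡_ _≡_ d →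
                          Injective _≡_ _≡_ code-fact
    code-fact-injective c-inj d-inj {φ} {ψ} e =
      let p , q = pair-injective (tag φ) (tag ψ) e in inj φ ψ p q
      where
      inj : ∀ φ ψ → tag φ ≡ tag ψ → content φ ≡ content ψ → φ ≡ ψ
      inj (vertex m) (vertex n) _ e = cong vertex e
      inj (label m s) (label n t) _ e with pair-injective m n e
      ... | refl , q = cong (label m) (c-inj q)
      inj (edge m i m′ j x) (edge n k n′ l y) _ e with pair-injective m n e
      ... | refl , e₁ with pair-injective (toℕ i) (toℕ k) e₁
      ... | p₁ , e₂ with pair-injective m′ n′ e₂
      ... | refl , e₃ with pair-injective (toℕ j) (toℕ l) e₃
      ... | p₂ , e₄ with toℕ-injective p₁ | toℕ-injective p₂ | d-inj e₄
      ... | refl | refl | refl = refl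

  infix 4 _⊨_

  _⊨_ : Graph → Fact V → Set
  G ⊨ vertex v       = v ∈ vertices G
  G ⊨ label v s      = (v , s) ∈ σ G
  G ⊨ edge u i v j d = ((u , i) , (v , j) , d) ∈ δ G

  about-vertex : ∀ G {φ v} → φ about v → G ⊨ φ → v ∈ vertices G
  about-vertex G vertex = id
  about-vertex G label  = σ-dom G
  about-vertex G source = proj₁ ∘ δ-dom G
  about-vertex G target = proj₂ ∘ δ-dom G

  infix 4 _⊑_ _⊑[_]_

  _⊑_ : Graph → Graph → Set
  G ⊑ H = ∀ φ → G ⊨ φ → H ⊨ φ

  _⊑[_]_ : Graph → V → Graph → Set
  G ⊑[ v ] H = ∀ {φ} → φ about v → G ⊨ φ → H ⊨ φ

  -- This is equality of the stars at `v`, by `agree⇒star` and `star⇒agree`, in a form without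
  -- induced subgraphs.
  Agree : Graph → Graph → V → Set
  Agree G H v = G ⊑[ v ] H × H ⊑[ v ] G

  agree-sym : ∀ {G H v} → Agree G H v → Agree H G v
  agree-sym = swap

  agree-trans : ∀ {G H K v} → Agree G H v → Agree H K v → Agree G K v
  agree-trans (p , p′) (q , q′) = (λ a → q a ∘ p a) , (λ a → p′ a ∘ q′ a)

  ≈-intro : ∀ {G H} → G ⊑ H → H ⊑ G → G ≈ H
  ≈-intro p q = record
    { vertices-≐ = p (vertex _) , q (vertex _)
    ; σ-≐        = (λ { {v , s} → p (label v s) }) , (λ { {v , s} → q (label v s) })
    ; δ-≐        = (λ { {(u , i) , (v , j) , d} → p (edge u i v j d) })
                 , (λ { {(u , i) , (v , j) , d} → q (edge u i v j d) })
    }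

  ≈⇒⊑ : ∀ {G H} → G ≈ H → G ⊑ H
  ≈⇒⊑ e (vertex v)       = proj₁ (vertices-≐ e)
  ≈⇒⊑ e (label v s)      = proj₁ (σ-≐ e)
  ≈⇒⊑ e (edge u i v j d) = proj₁ (δ-≐ e)

  ≈-sym : ∀ {G H} → G ≈ H → H ≈ G
  ≈-sym = Setoid.sym 𝒢

  ≈-trans : ∀ {G H K} → G ≈ H → H ≈ K → G ≈ K
  ≈-trans = Setoid.trans 𝒢

  ≈⇒agree : ∀ {G H v} → G ≈ H → Agree G H v
  ≈⇒agree e = (λ {φ} _ → ≈⇒⊑ e φ) , (λ {φ} _ → ≈⇒⊑ (≈-sym e) φ)

  agree⇒≈ : ∀ {G H} → (∀ v → Agree G H v) → G ≈ H
  agree⇒≈ {G} {H} h = ≈-intro (everywhere (proj₁ (h _))) (everywhere (proj₂ (h _)))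
    where
    everywhere : ∀ {G H} → (∀ {v} → G ⊑[ v ] H) → G ⊑ H
    everywhere h (vertex v)       = h vertex
    everywhere h (label v s)      = h label
    everywhere h (edge u i v j d) = h source

  -- Walks and balls

  ⌢-sym : ∀ {G u v} → G ⊢ u ⌢ v → G ⊢ v ⌢ u
  ⌢-sym (i , j , d , e) = j , i , d , Sum.swap e

  ⌢-vertices : ∀ G {u v} → G ⊢ u ⌢ v → u ∈ vertices G × v ∈ vertices G
  ⌢-vertices G (_ , _ , _ , inj₁ e) = δ-dom G e
  ⌢-vertices G (_ , _ , _ , inj₂ e) = swap (δ-dom G e)

  ⌢-mono : ∀ {G H u v} → G ⊑[ u ] H → G ⊢ u ⌢ v → H ⊢ u ⌢ v
  ⌢-mono h (i , j , d , inj₁ e) = i , j , d , inj₁ (h source e)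
  ⌢-mono h (i , j , d , inj₂ e) = i , j , d , inj₂ (h target e)

  walk-mono : ∀ {G H} k {u v} → (∀ {j w} → j < k → G ⊢ u ⌢[ j ] w → G ⊑[ w ] H) →
              G ⊢ u ⌢[ k ] v → H ⊢ u ⌢[ k ] v
  walk-mono zero    h e = e
  walk-mono (ℕ.suc k) h (w , a , p) =
    w , ⌢-mono (h (s≤s z≤n) refl) a , walk-mono k (λ lt q → h (s≤s lt) (w , a , q)) p

  walk-snoc : ∀ {G} k {u v w} → G ⊢ u ⌢[ k ] v → G ⊢ v ⌢ w → G ⊢ u ⌢[ ℕ.suc k ] w
  walk-snoc zero      refl        a = _ , a , refl
  walk-snoc (ℕ.suc k) (_ , b , p) a = _ , b , walk-snoc k p a

  -- This is equality of the envelopes of `v`. Walks are taken in `G` only, but `ball-walk` and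
  -- `ball-walk⁻¹` show that `H` has the same walks up to length `r`.
  AgreeBall : ℕ → Graph → Graph → V → Set
  AgreeBall r G H v = ∀ {k w} → k ≤ r → G ⊢ v ⌢[ k ] w → Agree G H w

  ball-walk : ∀ {r G H v} → AgreeBall r G H v → ∀ k {w} → k ≤ r →
              G ⊢ v ⌢[ k ] w → H ⊢ v ⌢[ k ] w
  ball-walk b k k≤r = walk-mono k (λ j<k → proj₁ ∘ b (≤-trans (<⇒≤ j<k) k≤r))

  -- The first step leaves `v`, where the graphs agree, so it exists in `G` too. The rest starts at
  -- the centre of a ball of agreement with radius one less.
  ball-walk⁻¹ : ∀ {r G H v} → AgreeBall r G H v → ∀ k {w} → k ≤ r →
                H ⊢ v ⌢[ k ] w → G ⊢ v ⌢[ k ] w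
  ball-walk⁻¹ b zero _ e = e
  ball-walk⁻¹ b (ℕ.suc k) (s≤s k≤r) (w , a , p) =
    w , a′ , ball-walk⁻¹ (λ le q → b (s≤s le) (w , a′ , q)) k k≤r p
    where a′ = ⌢-mono (proj₂ (b z≤n refl)) a

  ball-sym : ∀ {r G H v} → AgreeBall r G H v → AgreeBall r H G v
  ball-sym b le p = agree-sym (b le (ball-walk⁻¹ b _ le p))

  -- Every point of a walk other than its start is the end of an edge, hence a vertex; only the
  -- start may lie outside `G`.
  ball-intro : ∀ {r G H v} → (∀ {w} → w ≡ v ⊎ w ∈ vertices G → Agree G H w) → AgreeBall r G H v
  ball-intro h {zero} _ refl = h (inj₁ refl)
  ball-intro {G = G} h {ℕ.suc k} _ p = h (inj₂ (end k p))
    where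
    end : ∀ k {u w} → G ⊢ u ⌢[ ℕ.suc k ] w → w ∈ vertices G
    end zero      (_ , a , refl) = proj₂ (⌢-vertices G a)
    end (ℕ.suc k) (_ , _ , p)    = end k p

  ≈⇒ball : ∀ {r G H v} → G ≈ H → AgreeBall r G H v
  ≈⇒ball e _ _ = ≈⇒agree e

  -- Stars and envelopes in terms of agreement

  module _ {G H : Graph} {W W₁ : Pred V 0ℓ} where

    -- Every label and edge of the induced subgraph is about a point of `vertices G ∩ W`, and every
    -- vertex is such a point or is joined to one by an edge.
    induced-mono : (∀ {w} → w ∈ vertices G ∩ W → G ⊑[ w ] H × w ∈ W₁) →
                   induced G W ⊑ induced H W₁
    induced-mono h = mono
      where
      W′⊆ : vertices G ∩ W ⊆ vertices H ∩ W₁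
      W′⊆ m = proj₁ (h m) vertex (proj₁ m) , proj₂ (h m)

      N⊆ : neighbours G 1 (vertices G ∩ W) ⊆ neighbours H 1 (vertices H ∩ W₁)
      N⊆ (_ , u , m , zero , _ , refl) = proj₁ (W′⊆ m) , u , W′⊆ m , 0 , z≤n , refl
      N⊆ (_ , u , m , 1 , _ , _ , a , refl) =
        let a′ = ⌢-mono (proj₁ (h m)) a in
        proj₂ (⌢-vertices H a′) , u , W′⊆ m , 1 , ≤-refl , _ , a′ , refl
      N⊆ (_ , _ , _ , ℕ.suc (ℕ.suc _) , s≤s () , _)

      mono : induced G W ⊑ induced H W₁
      mono (vertex v)       = N⊆
      mono (label v s)      (m , e) = W′⊆ m , proj₁ (h m) label e
      mono (edge u i v j d) (inj₁ (n , m) , e) = inj₁ (N⊆ n , W′⊆ m) , proj₁ (h m) target e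
      mono (edge u i v j d) (inj₂ (m , n) , e) = inj₂ (W′⊆ m , N⊆ n) , proj₁ (h m) source e

    -- The edges at a point of `W` survive in the induced subgraph, since their other ends are
    -- radius-one neighbours. If `w` is not a vertex, no fact about it holds in `G`.
    induced-reflect : induced G W ⊑ induced H W₁ → ∀ {w} → (w ∈ vertices G → w ∈ W) → G ⊑[ w ] H
    induced-reflect h {w} w∈ {φ} a e with about-vertex G a e
    ... | w∈G = go a e
      where
      m = w∈G , w∈ w∈G
      go : ∀ {φ} → φ about w → G ⊨ φ → H ⊨ φ
      go vertex _ = proj₁ (h (vertex w) (w∈G , w , m , 0 , z≤n , refl))
      go label  e = proj₂ (h (label _ _) (m , e))
      go (source {i = i} {v} {j} {d}) e = proj₂ (h (edge w i v j d)
        (inj₂ (m , proj₂ (δ-dom G e) , w , m , 1 , ≤-refl , v , (i , j , d , inj₁ e) , refl) , e))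
      go (target {u} {i} {_} {j} {d}) e = proj₂ (h (edge u i w j d)
        (inj₁ ((proj₁ (δ-dom G e) , w , m , 1 , ≤-refl , u , (j , i , d , inj₂ e) , refl) , m) , e))

  agree⇒star : ∀ {G H v} → Agree G H v → star G v ≈ star H v
  agree⇒star (p , q) = ≈-intro (induced-mono λ { (_ , refl) → p , refl })
                               (induced-mono λ { (_ , refl) → q , refl })

  star⇒agree : ∀ {G H v} → star G v ≈ star H v → Agree G H v
  star⇒agree e = induced-reflect (≈⇒⊑ e) (λ _ → refl) , induced-reflect (≈⇒⊑ (≈-sym e)) (λ _ → refl)

  ball⇒envelope : ∀ {r G H v} → AgreeBall r G H v → envelope G r ｛ v ｝ ≈• envelope H r ｛ v ｝
  ball⇒envelope {r} b = ≈-intro (half b) (half (ball-sym b)) , id , id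
    where
    half : ∀ {G H v} → AgreeBall r G H v →
           induced G (neighbours G r ｛ v ｝) ⊑ induced H (neighbours H r ｛ v ｝)
    half b = induced-mono λ { (_ , w∈G , u , refl , k , le , p) →
      proj₁ (b le p) , proj₁ (b le p) vertex w∈G , u , refl , k , le , ball-walk b k le p }

  envelope⇒ball : ∀ {r G H v} → envelope G r ｛ v ｝ ≈• envelope H r ｛ v ｝ → AgreeBall r G H v
  envelope⇒ball {r} (e , _) {k} le p =
    -- The walk is first carried over to `H`, so that `half` applies with the two graphs exchanged.
    half e le p , half (≈-sym e) le (walk-mono k (λ j<k → half e (≤-trans (<⇒≤ j<k) le)) p)
    where
    half : ∀ {G H v k w} → induced G (neighbours G r ｛ v ｝) ≈ induced H (neighbours H r ｛ v ｝) →
           k ≤ r → G ⊢ v ⌢[ k ] w → G ⊑[ w ] H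
    half e le p = induced-reflect (≈⇒⊑ e) (λ w∈G → w∈G , _ , refl , _ , le , p)

  -- Disjoint unions and restrictions to closed sets

  module _ (A B : Graph) (disjoint : ∀ {v} → v ∈ vertices A → v ∉ vertices B) where

    union : Graph
    union = record
      { vertices     = vertices A ∪ vertices B
      ; countable    = countable-∪ (countable A) (countable B)
      ; σ            = σ A ∪ σ B
      ; σ-dom        = Sum.map (σ-dom A) (σ-dom B)
      ; σ-functional = λ
        { (inj₁ x) (inj₁ y) → σ-functional A x y
        ; (inj₂ x) (inj₂ y) → σ-functional B x y
        ; (inj₁ x) (inj₂ y) → ⊥-elim (disjoint (σ-dom A x) (σ-dom B y))
        ; (inj₂ x) (inj₁ y) → ⊥-elim (disjoint (σ-dom A y) (σ-dom B x)) }
      ; δ            = δ A ∪ δ B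
      ; δ-dom        = λ
        { (inj₁ x) → let u , v = δ-dom A x in inj₁ u , inj₁ v
        ; (inj₂ x) → let u , v = δ-dom B x in inj₂ u , inj₂ v }
      ; δ-functional = λ
        { (inj₁ x) (inj₁ y) → δ-functional A x y
        ; (inj₂ x) (inj₂ y) → δ-functional B x y
        ; (inj₁ x) (inj₂ y) → ⊥-elim (disjoint (proj₁ (δ-dom A x)) (proj₁ (δ-dom B y)))
        ; (inj₂ x) (inj₁ y) → ⊥-elim (disjoint (proj₁ (δ-dom A y)) (proj₁ (δ-dom B x))) }
      ; δ-onceˡ      = λ
        { (inj₁ x) (inj₁ y) → δ-onceˡ A x y
        ; (inj₂ x) (inj₂ y) → δ-onceˡ B x y
        ; (inj₁ x) (inj₂ y) → ⊥-elim (disjoint (proj₁ (δ-dom A x)) (proj₁ (δ-dom B y)))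
        ; (inj₂ x) (inj₁ y) → ⊥-elim (disjoint (proj₁ (δ-dom A y)) (proj₁ (δ-dom B x))) }
      ; δ-onceʳ      = λ
        { (inj₁ x) (inj₁ y) → δ-onceʳ A x y
        ; (inj₂ x) (inj₂ y) → δ-onceʳ B x y
        ; (inj₁ x) (inj₂ y) → ⊥-elim (disjoint (proj₂ (δ-dom A x)) (proj₂ (δ-dom B y)))
        ; (inj₂ x) (inj₁ y) → ⊥-elim (disjoint (proj₂ (δ-dom A y)) (proj₂ (δ-dom B x))) }
      ; δ-onceˡʳ     = λ
        { (inj₁ x) (inj₁ y) → δ-onceˡʳ A x y
        ; (inj₂ x) (inj₂ y) → δ-onceˡʳ B x y
        ; (inj₁ x) (inj₂ y) → ⊥-elim (disjoint (proj₁ (δ-dom A x)) (proj₂ (δ-dom B y)))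
        ; (inj₂ x) (inj₁ y) → ⊥-elim (disjoint (proj₂ (δ-dom A y)) (proj₁ (δ-dom B x))) }
      }

    private
      ⊨-union : ∀ φ → A ⊨ φ ⊎ B ⊨ φ → union ⊨ φ
      ⊨-union (vertex _)       = id
      ⊨-union (label _ _)      = id
      ⊨-union (edge _ _ _ _ _) = id

      union-⊨ : ∀ φ → union ⊨ φ → A ⊨ φ ⊎ B ⊨ φ
      union-⊨ (vertex _)       = id
      union-⊨ (label _ _)      = id
      union-⊨ (edge _ _ _ _ _) = id

    union-agreeˡ : ∀ {v} → v ∉ vertices B → Agree A union v
    union-agreeˡ v∉B =
      (λ {φ} _ → ⊨-union φ ∘ inj₁) ,
      (λ {φ} a → [ id , (λ e → contradiction (about-vertex B a e) v∉B) ]′ ∘ union-⊨ φ)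

    union-agreeʳ : ∀ {v} → v ∉ vertices A → Agree B union v
    union-agreeʳ v∉A =
      (λ {φ} _ → ⊨-union φ ∘ inj₂) ,
      (λ {φ} a → [ (λ e → contradiction (about-vertex A a e) v∉A) , id ]′ ∘ union-⊨ φ)

  Closed : Pred V 0ℓ → Graph → Set
  Closed S G = ∀ {u w} → u ∈ S → G ⊢ u ⌢ w → w ∈ S

  Closed-∁ : ∀ {S G} → Closed S G → Closed (∁ S) G
  Closed-∁ {G = G} c u∉S a w∈S = u∉S (c w∈S (⌢-sym {G} a))

  restrict : Pred V 0ℓ → Graph → Graph
  restrict S G = record
    { vertices     = vertices G ∩ S
    ; countable    = (λ p → proj₁ (countable G) (proj₁ p)) ,
                     λ p q → proj₂ (countable G) (proj₁ p) (proj₁ q)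
    ; σ            = λ (v , s) → v ∈ S × (v , s) ∈ σ G
    ; σ-dom        = λ (v∈S , x) → σ-dom G x , v∈S
    ; σ-functional = λ (_ , x) (_ , y) → σ-functional G x y
    ; δ            = λ (p , q , d) → (proj₁ p ∈ S × proj₁ q ∈ S) × (p , q , d) ∈ δ G
    ; δ-dom        = λ ((u , v) , x) → (proj₁ (δ-dom G x) , u) , (proj₂ (δ-dom G x) , v)
    ; δ-functional = λ (_ , x) (_ , y) → δ-functional G x y
    ; δ-onceˡ      = λ (_ , x) (_ , y) → δ-onceˡ G x y
    ; δ-onceʳ      = λ (_ , x) (_ , y) → δ-onceʳ G x y
    ; δ-onceˡʳ     = λ (_ , x) (_ , y) → δ-onceˡʳ G x y
    }

  -- No edge leaves a closed set, so the restriction cuts none of the edges at `v`.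
  restrict-agree : ∀ {S G v} → Closed S G → v ∈ S → Agree (restrict S G) G v
  restrict-agree {S} {G} {v} c v∈S = sub , sup
    where
    sub : restrict S G ⊑[ v ] G
    sub vertex = proj₁
    sub label  = proj₂
    sub source = proj₂
    sub target = proj₂
    sup : G ⊑[ v ] restrict S G
    sup vertex e = e , v∈S
    sup label  e = v∈S , e
    sup source e = (v∈S , c v∈S (_ , _ , _ , inj₁ e)) , e
    sup target e = (c v∈S (_ , _ , _ , inj₂ e) , v∈S) , e

  restrict-cong : ∀ {S G H} → (∀ {v} → v ∈ S → Agree G H v) → restrict S G ≈ restrict S H
  restrict-cong {S} h = ≈-intro (half (proj₁ ∘ h)) (half (proj₂ ∘ h))
    where
    half : ∀ {G H} → (∀ {v} → v ∈ S → G ⊑[ v ] H) → restrict S G ⊑ restrict S H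
    half h (vertex v)       (e , v∈S) = h v∈S vertex e , v∈S
    half h (label v s)      (v∈S , e) = v∈S , h v∈S label e
    half h (edge u i v j d) (m , e)   = m , h (proj₁ m) source e

  -- Renaming

  map-fact-cong : ∀ {X Y} {f g : X → Y} → (∀ x → f x ≡ g x) → ∀ φ → map-fact f φ ≡ map-fact g φ
  map-fact-cong h (vertex v)       = cong vertex (h v)
  map-fact-cong h (label v s)      = cong (λ v → label v s) (h v)
  map-fact-cong h (edge u i v j d) = cong₂ (λ u v → edge u i v j d) (h u) (h v)

  map-fact-id : ∀ {X} (φ : Fact X) → map-fact id φ ≡ φ
  map-fact-id (vertex _)       = refl
  map-fact-id (label _ _)      = refl
  map-fact-id (edge _ _ _ _ _) = refl

  map-fact-∘ : ∀ {X Y Z : Set} (f : Y → Z) (g : X → Y) φ → map-fact f (map-fact g φ) ≡ map-fact (f ∘ g) φ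
  map-fact-∘ f g (vertex _)       = refl
  map-fact-∘ f g (label _ _)      = refl
  map-fact-∘ f g (edge _ _ _ _ _) = refl

  rename-⊨ : ∀ R G φ → (rename R G ⊨ φ) ≡ (G ⊨ map-fact (Inverse.from R) φ)
  rename-⊨ R G (vertex _)       = refl
  rename-⊨ R G (label _ _)      = refl
  rename-⊨ R G (edge _ _ _ _ _) = refl

  rename-⊑ : ∀ R {G H} → G ⊑ H → rename R G ⊑ rename R H
  rename-⊑ R {G} {H} h φ e =
    subst id (sym (rename-⊨ R H φ)) (h (map-fact (Inverse.from R) φ) (subst id (rename-⊨ R G φ) e))

  rename-cong : ∀ R {G H} → G ≈ H → rename R G ≈ rename R H
  rename-cong R e = ≈-intro (rename-⊑ R (≈⇒⊑ e)) (rename-⊑ R (≈⇒⊑ (≈-sym e)))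

  rename-agree : ∀ R {G H v} → Agree G H (Inverse.from R v) → Agree (rename R G) (rename R H) v
  rename-agree R (p , q) = half p , half q
    where
    half : ∀ {G H v} → G ⊑[ Inverse.from R v ] H → rename R G ⊑[ v ] rename R H
    half {G} {H} h {φ} a e =
      subst id (sym (rename-⊨ R H φ)) (h (about-map (Inverse.from R) a) (subst id (rename-⊨ R G φ) e))

  rename-walk : ∀ R G k {u v} → rename R G ⊢ u ⌢[ k ] v →
                G ⊢ Inverse.from R u ⌢[ k ] Inverse.from R v
  rename-walk R G zero        refl        = refl
  rename-walk R G (ℕ.suc k) (w , a , p) = Inverse.from R w , a , rename-walk R G k p

  rename-ball : ∀ R {r G H v} → AgreeBall r G H (Inverse.from R v) →
                AgreeBall r (rename R G) (rename R H) v
  rename-ball R {G = G} b {k} le p = rename-agree R (b le (rename-walk R G k p))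

  rename²-⊨ : ∀ R R′ G {f} → (∀ v → Inverse.from R′ (Inverse.from R v) ≡ f v) → ∀ φ →
              (rename R (rename R′ G) ⊨ φ) ≡ (G ⊨ map-fact f φ)
  rename²-⊨ R R′ G h φ =
    trans (rename-⊨ R (rename R′ G) φ) (trans (rename-⊨ R′ G (map-fact (Inverse.from R) φ))
      (cong (G ⊨_) (trans (map-fact-∘ _ _ φ) (map-fact-cong h φ))))

  ≈-intro-≡ : ∀ {G H} → (∀ φ → (G ⊨ φ) ≡ (H ⊨ φ)) → G ≈ H
  ≈-intro-≡ h = ≈-intro (λ φ → subst id (h φ)) (λ φ → subst id (sym (h φ)))

  rename-inverse : ∀ R R′ G → (∀ v → Inverse.from R′ (Inverse.from R v) ≡ v) →
                   rename R (rename R′ G) ≈ G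
  rename-inverse R R′ G h =
    ≈-intro-≡ (λ φ → trans (rename²-⊨ R R′ G h φ) (cong (G ⊨_) (map-fact-id φ)))

  rename-swap : ∀ R₁ R₂ R₃ R₄ G →
    (∀ v → Inverse.from R₂ (Inverse.from R₁ v) ≡ Inverse.from R₄ (Inverse.from R₃ v)) →
    rename R₁ (rename R₂ G) ≈ rename R₃ (rename R₄ G)
  rename-swap R₁ R₂ R₃ R₄ G h =
    ≈-intro-≡ (λ φ → trans (rename²-⊨ R₁ R₂ G h φ) (sym (rename²-⊨ R₃ R₄ G (λ _ → refl) φ)))

  rename-agree⁻¹ : ∀ R {G H v} → Agree (rename R G) (rename R H) v → Agree G H (Inverse.from R v)
  rename-agree⁻¹ R {G} {H} {v} h =
    agree-trans (≈⇒agree (≈-sym (inv G))) (agree-trans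
      (rename-agree (↔-sym R) (subst (Agree (rename R G) (rename R H)) (sym (Inverse.strictlyInverseˡ R v)) h))
      (≈⇒agree (inv H)))
    where
    inv : ∀ G → rename (↔-sym R) (rename R G) ≈ G
    inv G = rename-inverse (↔-sym R) R G (Inverse.strictlyInverseʳ R)

  -- Limits of graphs along a filter

  PortNeighbour : Graph → V → Fin π → V → Set
  PortNeighbour G u i w = ∃[ j ] ∃[ d ]
    (((u , i) , (w , j) , d) ∈ δ G ⊎ ((w , j) , (u , i) , d) ∈ δ G)

  -- A port occurs at most once in the domain of `δ`, on either side. Hence following port `i` is a
  -- partial function, and words of ports lead to at most one vertex.
  port-functional : ∀ G {u i w w′} → PortNeighbour G u i w → PortNeighbour G u i w′ → w ≡ w′
  port-functional G (_ , _ , inj₁ x) (_ , _ , inj₁ y) = cong proj₁ (δ-onceˡ G x y)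
  port-functional G (_ , _ , inj₂ x) (_ , _ , inj₂ y) = cong proj₁ (δ-onceʳ G x y)
  port-functional G (_ , _ , inj₁ x) (_ , _ , inj₂ y) = ⊥-elim (δ-onceˡʳ G x y)
  port-functional G (_ , _ , inj₂ x) (_ , _ , inj₁ y) = ⊥-elim (δ-onceˡʳ G y x)

  module Limit (ι : ℕ → V) (ι-injective : Injective _≡_ _≡_ ι) (𝓕 : Filter) (G : ℕ → Graph)
               (decided : ∀ φ → Decides 𝓕 (λ n → G n ⊨ map-fact ι φ)) where

    private
      Ev : Pred ℕ 0ℓ → Set
      Ev = Eventually 𝓕

      meet : ∀ {Φ Ψ : Pred ℕ 0ℓ} → Ev Φ → Ev Ψ → ∃[ n ] (Φ n × Ψ n)
      meet p q = ev-∃ 𝓕 (ev-× 𝓕 p q)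

    Named : Pred V 0ℓ
    Named v = ∃[ m ] (ι m ≡ v)

    -- The named facts that hold eventually. Any two of them hold together in some `G n`, so the
    -- conditions on `δ` and `σ` are inherited; the names witness countability.
    limit : Graph
    limit = record
      { vertices     = λ v → Named v × Ev (λ n → v ∈ vertices (G n))
      ; countable    = (λ ((m , _) , _) → m) ,
                       λ { ((m , e) , _) ((_ , e′) , _) refl → trans (sym e) e′ }
      ; σ            = λ (v , s) → Named v × Ev (λ n → (v , s) ∈ σ (G n))
      ; σ-dom        = λ (m , x) → m , ev-map 𝓕 (λ {n} → σ-dom (G n)) x
      ; σ-functional = λ (_ , x) (_ , y) → let n , a , b = meet x y in σ-functional (G n) a b
      ; δ            = λ (p , q , d) → (Named (proj₁ p) × Named (proj₁ q)) ×
                                       Ev (λ n → (p , q , d) ∈ δ (G n))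
      ; δ-dom        = λ ((m , m′) , x) → (m , ev-map 𝓕 (λ {n} → proj₁ ∘ δ-dom (G n)) x) ,
                                          (m′ , ev-map 𝓕 (λ {n} → proj₂ ∘ δ-dom (G n)) x)
      ; δ-functional = λ (_ , x) (_ , y) → let n , a , b = meet x y in δ-functional (G n) a b
      ; δ-onceˡ      = λ (_ , x) (_ , y) → let n , a , b = meet x y in δ-onceˡ (G n) a b
      ; δ-onceʳ      = λ (_ , x) (_ , y) → let n , a , b = meet x y in δ-onceʳ (G n) a b
      ; δ-onceˡʳ     = λ (_ , x) (_ , y) → let n , a , b = meet x y in δ-onceˡʳ (G n) a b
      }

    private
      limit-intro : ∀ φ → Ev (λ n → G n ⊨ map-fact ι φ) → limit ⊨ map-fact ι φ
      limit-intro (vertex m)        e = (m , refl) , e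
      limit-intro (label m s)       e = (m , refl) , e
      limit-intro (edge m i m′ j d) e = ((m , refl) , (m′ , refl)) , e

      limit-elim : ∀ φ → limit ⊨ φ → Ev (λ n → G n ⊨ φ)
      limit-elim (vertex _)       = proj₂
      limit-elim (label _ _)      = proj₂
      limit-elim (edge _ _ _ _ _) = proj₂

      Correct : Fact ℕ → Pred ℕ 0ℓ
      Correct φ n = (limit ⊨ map-fact ι φ → G n ⊨ map-fact ι φ) ×
                    (G n ⊨ map-fact ι φ → limit ⊨ map-fact ι φ)

      ev-correct : ∀ φ → Ev (Correct φ)
      ev-correct φ with decided φ
      ... | inj₁ e = ev-map 𝓕 (λ x → const x , const (limit-intro φ e)) e
      ... | inj₂ e = ev-map 𝓕 (λ ¬x → (λ l → let n , a , ¬a = meet (limit-elim (map-fact ι φ) l) e in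
                                              ⊥-elim (¬a a)) , ⊥-elim ∘ ¬x) e

    module Bounded (Σ-finite : Finite Σ) (Δ-finite : Finite Δ) (bound : Fin π → ℕ → ℕ)
             (bounded : ∀ n {m i w} → PortNeighbour (G n) (ι m) i w →
                        ∃[ m′ ] (m′ < bound i m × ι m′ ≡ w)) where

      private
        limit-bounded : ∀ {m i w} → PortNeighbour limit (ι m) i w →
                        ∃[ m′ ] (m′ < bound i m × ι m′ ≡ w)
        limit-bounded (j , d , inj₁ (_ , e)) = let n , x = ev-∃ 𝓕 e in bounded n (j , d , inj₁ x)
        limit-bounded (j , d , inj₂ (_ , e)) = let n , x = ev-∃ 𝓕 e in bounded n (j , d , inj₂ x)

        -- The bound on the names of neighbours and the finiteness of `Σ`, `Δ` and the ports make
        -- this a finite conjunction, so it holds eventually. It covers every fact about `ι m`,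
        -- since an edge at `ι m` in either graph ends at a name below the bound.
        CorrectAt : ℕ → Pred ℕ 0ℓ
        CorrectAt m n = Correct (vertex m) n × (∀ s → Correct (label m s) n) ×
          (∀ i {m′} → m′ < bound i m → ∀ j d →
             Correct (edge m i m′ j d) n × Correct (edge m′ j m i d) n)

        ev-correct-at : ∀ m → Ev (CorrectAt m)
        ev-correct-at m =
          ev-× 𝓕 (ev-correct (vertex m)) (
          ev-× 𝓕 (ev-∀ 𝓕 Σ-finite λ s → ev-correct (label m s)) (
          ev-∀Fin 𝓕 π λ i → ev-∀< 𝓕 (bound i m) λ m′ → ev-∀Fin 𝓕 π λ j → ev-∀ 𝓕 Δ-finite λ d →
          ev-× 𝓕 (ev-correct (edge m i m′ j d)) (ev-correct (edge m′ j m i d))))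

        correct⇒agree : ∀ {m n} → CorrectAt m n → Agree limit (G n) (ι m)
        correct⇒agree {m} {n} (cv , cl , ce) = sub , sup
          where
          sub : limit ⊑[ ι m ] G n
          sub vertex = proj₁ cv
          sub label  = proj₁ (cl _)
          sub source e with limit-bounded (_ , _ , inj₁ e)
          ... | m′ , lt , refl = proj₁ (proj₁ (ce _ lt _ _)) e
          sub target e with limit-bounded (_ , _ , inj₂ e)
          ... | m′ , lt , refl = proj₁ (proj₂ (ce _ lt _ _)) e
          sup : G n ⊑[ ι m ] limit
          sup vertex = proj₂ cv
          sup label  = proj₂ (cl _)
          sup source e with bounded n (_ , _ , inj₁ e)
          ... | m′ , lt , refl = proj₂ (proj₁ (ce _ lt _ _)) e
          sup target e with bounded n (_ , _ , inj₂ e)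
          ... | m′ , lt , refl = proj₂ (proj₂ (ce _ lt _ _)) e

      limit-agree : ∀ m → Ev (λ n → Agree limit (G n) (ι m))
      limit-agree m = ev-map 𝓕 correct⇒agree (ev-correct-at m)

      -- A ball of radius `r + 1` is its centre with balls of radius `r` around the neighbours.
      -- These are among finitely many names that do not depend on `n`.
      limit-ball : ∀ r m → Ev (λ n → AgreeBall r limit (G n) (ι m))
      limit-ball zero m = ev-map 𝓕 (λ { a {zero} _ refl → a }) (limit-agree m)
      limit-ball (ℕ.suc r) m =
        ev-map 𝓕 (λ { (a , _) {zero} _ refl → a
                    ; (_ , b) {ℕ.suc k} (s≤s le) (w , (i , p) , q) → step b le i p q })
          (ev-× 𝓕 (limit-agree m)
            (ev-∀Fin 𝓕 π λ i → ev-∀< 𝓕 (bound i m) λ m′ → limit-ball r m′))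
        where
        step : ∀ {n} → (∀ i {m′} → m′ < bound i m → AgreeBall r limit (G n) (ι m′)) →
               ∀ {k w v} → k ≤ r → ∀ i → PortNeighbour limit (ι m) i w →
               limit ⊢ w ⌢[ k ] v → Agree limit (G n) v
        step b le i p q with limit-bounded p
        ... | m′ , lt , refl = b i lt le q

-- Compactness and causality of the inverse

module Causality (em : ExcludedMiddle (suc 0ℓ)) (V Σ Δ : Set) (π : ℕ)
                 (uncountable : Uncountable V) where

  open Graphs V Σ Δ π
  open Classical em

  -- Naming vertices by words of ports

  module Involution (_~_ : V → V → Set) (~-sym : ∀ {x y} → x ~ y → y ~ x)
                    (~-functional : ∀ {x y z} → x ~ y → x ~ z → y ≡ z) where

    -- The partial involution `~` extended by the identity, which makes it a bijection of all names.
    swap~ : V → V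
    swap~ x with em₀ {∃[ y ] (x ~ y)}
    ... | yes (y , _) = y
    ... | no _        = x

    swap~-yes : ∀ {x y} → x ~ y → swap~ x ≡ y
    swap~-yes {x} x~y with em₀ {∃[ y ] (x ~ y)}
    ... | yes (_ , x~z) = ~-functional x~z x~y
    ... | no ∄          = contradiction (_ , x~y) ∄

    swap~-no : ∀ {x} → ¬ (∃[ y ] (x ~ y)) → swap~ x ≡ x
    swap~-no {x} ∄ with em₀ {∃[ y ] (x ~ y)}
    ... | yes p = contradiction p ∄
    ... | no _  = refl

    swap~-involutive : ∀ x → swap~ (swap~ x) ≡ x
    swap~-involutive x = by-cases em₀
      where
      by-cases : Dec (∃[ y ] (x ~ y)) → swap~ (swap~ x) ≡ x
      by-cases (yes (y , x~y)) = trans (cong swap~ (swap~-yes x~y)) (swap~-yes (~-sym x~y))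
      by-cases (no ∄) = trans (cong swap~ (swap~-no ∄)) (swap~-no ∄)

    swap↔ : V ↔ V
    swap↔ = mk↔ₛ′ swap~ swap~ swap~-involutive swap~-involutive

  -- A port to follow in `P` or a port to follow in `Q`, so that one naming serves both graphs.
  Letter : Set
  Letter = Fin π ⊎ Fin π

  code-letter : Letter → ℕ
  code-letter = code-⊎ toℕ toℕ

  code-word : List Letter → ℕ
  code-word = code-list code-letter

  code-word-injective : Injective _≡_ _≡_ code-word
  code-word-injective = code-list-injective code-letter (code-⊎-injective toℕ-injective toℕ-injective)

  Step : Graph → Graph → Letter → V → V → Set
  Step P Q (inj₁ i) u w = PortNeighbour P u i w
  Step P Q (inj₂ i) u w = PortNeighbour Q u i w

  -- One `suc` comes from the code of a nonempty word, the other makes the bound strict.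
  bound : Letter → ℕ → ℕ
  bound a m = ℕ.suc (ℕ.suc (pair (code-letter a) m))

  Around : V → Graph → Graph → Pred V 0ℓ
  Around v P Q = ｛ v ｝ ∪ (vertices P ∪ vertices Q)

  -- The name of a vertex is the least code of a word of ports leading to it
  -- from v.  A port neighbour of a vertex named m then has a name bounded in
  -- terms of m and the port alone, whatever the graphs are.
  module Naming (v : V) (P Q : Graph) (ι : ℕ → V) (ι-injective : Injective _≡_ _≡_ ι)
                (ι-fresh : ∀ m → ι m ∉ Around v P Q) where

    -- The head of the list is the last step, so prolonging a walk is a cons and `code-list` bounds
    -- the new code by the old one.
    Leads : List Letter → V → Set
    Leads []       x = v ≡ x
    Leads (a ∷ as) x = ∃[ y ] (Leads as y × Step P Q a y x)

    step-functional : ∀ a {u w w′} → Step P Q a u w → Step P Q a u w′ → w ≡ w′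
    step-functional (inj₁ i) = port-functional P
    step-functional (inj₂ i) = port-functional Q

    step-target : ∀ a {u w} → Step P Q a u w → w ∈ vertices P ∪ vertices Q
    step-target (inj₁ i) s = inj₁ (proj₂ (⌢-vertices P (i , s)))
    step-target (inj₂ i) s = inj₂ (proj₂ (⌢-vertices Q (i , s)))

    step-source : ∀ a {u w} → Step P Q a u w → u ∈ vertices P ∪ vertices Q
    step-source (inj₁ i) s = inj₁ (proj₁ (⌢-vertices P (i , s)))
    step-source (inj₂ i) s = inj₂ (proj₁ (⌢-vertices Q (i , s)))

    leads-functional : ∀ as {x y} → Leads as x → Leads as y → x ≡ y
    leads-functional []       refl refl = refl
    leads-functional (a ∷ as) (_ , l , s) (_ , l′ , s′) with leads-functional as l l′
    ... | refl = step-functional a s s′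

    leads-around : ∀ as {x} → Leads as x → x ∈ Around v P Q
    leads-around []       e           = inj₁ e
    leads-around (a ∷ as) (_ , _ , s) = inj₂ (step-target a s)

    Coded : V → Pred ℕ 0ℓ
    Coded x m = ∃[ as ] (code-word as ≡ m × Leads as x)

    Name : V → Pred ℕ 0ℓ
    Name x m = Coded x m × (∀ {k} → Coded x k → m ≤ k)

    name-exists : ∀ {x k} → Coded x k → ∃[ m ] (m ≤ k × Name x m)
    name-exists {x} c = let m , n , min = least (Coded x) c in m , min c , n , min

    name-unique : ∀ {x m m′} → Name x m → Name x m′ → m ≡ m′
    name-unique (c , min) (c′ , min′) = ≤-antisym (min c′) (min′ c)

    name-injective : ∀ {x y m} → Name x m → Name y m → x ≡ y
    name-injective ((as , e , l) , _) ((bs , e′ , l′) , _) with code-word-injective (trans e (sym e′))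
    ... | refl = leads-functional as l l′

    name-around : ∀ {x m} → Name x m → x ∈ Around v P Q
    name-around ((as , _ , l) , _) = leads-around as l

    _↦_ : V → V → Set
    x ↦ y = ∃[ m ] (Name x m × ι m ≡ y)

    _~_ : V → V → Set
    x ~ y = x ↦ y ⊎ y ↦ x

    -- Named vertices lie in `Around v P Q` and the values of `ι` outside it, so no point is on both
    -- sides of `↦`. On each side names are unique and injective.
    ~-functional : ∀ {x y z} → x ~ y → x ~ z → y ≡ z
    ~-functional (inj₁ (m , n , e)) (inj₁ (m′ , n′ , e′)) =
      trans (sym e) (trans (cong ι (name-unique n n′)) e′)
    ~-functional (inj₂ (m , n , e)) (inj₂ (m′ , n′ , e′)) with ι-injective (trans e (sym e′))
    ... | refl = name-injective n n′
    ~-functional (inj₁ (m , n , e)) (inj₂ (m′ , n′ , refl)) = contradiction (name-around n) (ι-fresh m′)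
    ~-functional (inj₂ (m , n , refl)) (inj₁ (m′ , n′ , e′)) = contradiction (name-around n′) (ι-fresh m)

    open Involution _~_ Sum.swap ~-functional

    renaming-map : V ↔ V
    renaming-map = swap↔

    centre : swap~ (ι 0) ≡ v
    -- The empty word leads to `v` and has the least possible code, 0.
    centre = swap~-yes (inj₂ (0 , (([] , refl , refl) , λ _ → z≤n) , refl))

    neighbours-bounded : ∀ a {m w} → Step P Q a (swap~ (ι m)) (swap~ w) →
                         ∃[ m′ ] (m′ < bound a m × ι m′ ≡ w)
    neighbours-bounded a {m} {w} s = by-cases em₀
      where
      by-cases : Dec (∃[ y ] (ι m ~ y)) → ∃[ m′ ] (m′ < bound a m × ι m′ ≡ w)
      -- An `ι m` that names no vertex is fixed by the renaming, so a step from it would make it a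
      -- vertex of `P` or `Q`, against freshness.
      by-cases (no ∄) =
        contradiction (inj₂ (subst (_∈ vertices P ∪ vertices Q) (swap~-no ∄) (step-source a s))) (ι-fresh m)
      by-cases (yes (y , inj₁ (_ , n , _))) = contradiction (name-around n) (ι-fresh m)
      by-cases (yes (y , inj₂ (m₁ , n , e))) with ι-injective e
      ... | refl =
        -- The word with code `m` leads to `y`, and prolonged by `a` it leads to the neighbour,
        -- whose least code `m′` can only be smaller.
        let (as , e , l) , _ = n
            s′ = subst (λ x → Step P Q a x (swap~ w)) (swap~-yes (inj₂ (m , n , refl))) s
            m′ , le , n′ = name-exists (a ∷ as , refl , y , l , s′)
        in m′ , s≤s (subst (λ k → m′ ≤ ℕ.suc (pair (code-letter a) k)) e le) ,
           trans (sym (swap~-yes (inj₁ (m′ , n′ , refl)))) (swap~-involutive w)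

  -- Inverses of local bijections

  module Bijection
    (Σ-finite : Finite Σ) (Δ-finite : Finite Δ)
    (T T⁻¹ : Graph → Graph)
    (T⁻¹-cong : ∀ {G H} → G ≈ H → T⁻¹ G ≈ T⁻¹ H)
    (T∘T⁻¹ : ∀ G → T (T⁻¹ G) ≈ G)
    (T⁻¹∘T : ∀ G → T⁻¹ (T G) ≈ G)
    (T-vertices : ∀ G → vertices (T G) ≐ vertices G)
    (T-rename : ∀ R G → T (rename R G) ≈ rename R (T G))
    (r : ℕ) (T-local : ∀ {G H v} → AgreeBall r G H v → Agree (T G) (T H) v)
    where

    -- T maps the disjoint union of T⁻¹ (K restricted to S) and T⁻¹ (K restricted
    -- to the complement of S) to K, because T is local and S is closed; hence
    -- this union is T⁻¹ K.
    T⁻¹-restrict : ∀ {S} K → Closed S K → ∀ {v} → v ∈ S → Agree (T⁻¹ (restrict S K)) (T⁻¹ K) v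
    T⁻¹-restrict {S} K c {v} v∈S =
      agree-trans (union-agreeˡ K₁ K₂ disjoint (outside v∈S))
        (≈⇒agree (≈-trans (≈-sym (T⁻¹∘T K₁₂)) (T⁻¹-cong (agree⇒≈ (λ _ → by-cases em₀)))))
      where
      K₁ = T⁻¹ (restrict S K)
      K₂ = T⁻¹ (restrict (∁ S) K)

      inside : ∀ {S} → vertices (T⁻¹ (restrict S K)) ⊆ S
      inside {S} x∈ = proj₂ (proj₁ (vertices-≐ (T∘T⁻¹ (restrict S K))) (proj₂ (T-vertices _) x∈))

      disjoint : ∀ {x} → x ∈ vertices K₁ → x ∉ vertices K₂
      disjoint x∈₁ x∈₂ = inside x∈₂ (inside x∈₁)

      outside : ∀ {x} → x ∈ S → x ∉ vertices K₂
      outside x∈S x∈₂ = inside x∈₂ x∈S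

      K₁₂ = union K₁ K₂ disjoint

      by-cases : ∀ {x} → Dec (x ∈ S) → Agree (T K₁₂) K x
      by-cases (yes x∈S) = agree-trans
        (agree-sym (T-local (ball-intro λ
          { (inj₁ refl) → union-agreeˡ K₁ K₂ disjoint (outside x∈S)
          ; (inj₂ w∈₁)  → union-agreeˡ K₁ K₂ disjoint (disjoint w∈₁) })))
        (agree-trans (≈⇒agree (T∘T⁻¹ _)) (restrict-agree c x∈S))
      by-cases (no x∉S) = agree-trans
        (agree-sym (T-local (ball-intro λ
          { (inj₁ refl) → union-agreeʳ K₁ K₂ disjoint (λ x∈₁ → x∉S (inside x∈₁))
          ; (inj₂ w∈₂)  → union-agreeʳ K₁ K₂ disjoint (λ w∈₁ → disjoint w∈₁ w∈₂) })))
        (agree-trans (≈⇒agree (T∘T⁻¹ _)) (restrict-agree (Closed-∁ {G = K} c) x∉S))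

    -- The component of `v` in `K` is closed in `L` as well, because the graphs agree all over it.
    -- Their restrictions to it are equal, and `T⁻¹-restrict` applies on both sides.
    T⁻¹-component : ∀ K L {v} → (∀ k {w} → K ⊢ v ⌢[ k ] w → Agree K L w) → Agree (T⁻¹ K) (T⁻¹ L) v
    T⁻¹-component K L {v} h =
      agree-trans (agree-sym (T⁻¹-restrict K closed (0 , refl)))
        (agree-trans (≈⇒agree (T⁻¹-cong (restrict-cong (λ (k , p) → h k p))))
          (T⁻¹-restrict L (λ { (k , p) a → closed (k , p) (⌢-mono (proj₂ (h k p)) a) }) (0 , refl)))
      where
      S : Pred V 0ℓ
      S w = ∃[ k ] (K ⊢ v ⌢[ k ] w)
      closed : Closed S K
      closed (k , p) a = ℕ.suc k , walk-snoc k p a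

    -- A failure of locality of `T⁻¹` at radius `n`, stated through the preimages `P` and `Q`.
    record Counterexample (n : ℕ) : Set₁ where
      field
        v        : V
        P Q      : Graph
        near     : AgreeBall n (T P) (T Q) v
        distinct : ¬ Agree P Q v

    -- The centre is the same for all `n` and the names of neighbours are bounded independently of
    -- `n`, as `Limit.Bounded` requires.
    record NormalCounterexample (ι : ℕ → V) (n : ℕ) : Set₁ where
      field
        P Q       : Graph
        near      : AgreeBall n (T P) (T Q) (ι 0)
        distinct  : ¬ Agree P Q (ι 0)
        bounded   : ∀ a {m w} → Step P Q a (ι m) w → ∃[ m′ ] (m′ < bound a m × ι m′ ≡ w)

    module _ {ι : ℕ → V} (ι-injective : Injective _≡_ _≡_ ι) where

      normalise : ∀ {n} (c : Counterexample n) → let open Counterexample c in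
                  (∀ m → ι m ∉ Around v P Q) → NormalCounterexample ι n
      normalise {n} c ι-fresh = record
        { P        = rename R P
        ; Q        = rename R Q
        ; near     = λ {k} k≤n p → agree-trans (≈⇒agree (T-rename R P)) (agree-trans
                       (rename-ball R (subst (AgreeBall n (T P) (T Q)) (sym centre) near) k≤n
                         (ball-walk {r = n} (≈⇒ball (T-rename R P)) k k≤n p))
                       (≈⇒agree (≈-sym (T-rename R Q))))
        ; distinct = λ h → distinct (subst (Agree P Q) centre (rename-agree⁻¹ R h))
        -- The split on the letter lets `Step` compute; an edge of a renamed graph is by definition
        -- an edge of the original one between the preimages.
        ; bounded  = λ { a@(inj₁ _) → neighbours-bounded a ; a@(inj₂ _) → neighbours-bounded a }
        }
        where
        open Counterexample c
        open Naming v P Q ι ι-injective ι-fresh renaming (renaming-map to R)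

      module _ (c : ∀ n → NormalCounterexample ι n) (𝓕 : Filter) where

        private
          module C n = NormalCounterexample (c n)
          Ev = Eventually 𝓕

        module _ (P-decided : ∀ φ → Decides 𝓕 (λ n → C.P n ⊨ map-fact ι φ))
                 (Q-decided : ∀ φ → Decides 𝓕 (λ n → C.Q n ⊨ map-fact ι φ)) where

          private
            module LP = Limit ι ι-injective 𝓕 C.P P-decided
            module LQ = Limit ι ι-injective 𝓕 C.Q Q-decided
            module BP = LP.Bounded Σ-finite Δ-finite (bound ∘ inj₁) (λ n → C.bounded n (inj₁ _))
            module BQ = LQ.Bounded Σ-finite Δ-finite (bound ∘ inj₂) (λ n → C.bounded n (inj₂ _))

            P∞ Q∞ : Graph
            P∞ = LP.limit
            Q∞ = LQ.limit

            TP-agree : ∀ m → Ev (λ n → Agree (T P∞) (T (C.P n)) (ι m))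
            TP-agree m = ev-map 𝓕 T-local (BP.limit-ball r m)

            TQ-agree : ∀ m → Ev (λ n → Agree (T Q∞) (T (C.Q n)) (ι m))
            TQ-agree m = ev-map 𝓕 T-local (BQ.limit-ball r m)

            -- `T` preserves vertices and all vertices of the limit are named, so the walk visits
            -- only named points. It has finitely many steps, hence eventually all of them exist in
            -- `T (C.P n)`.
            TP-walk : ∀ k {m w} → T P∞ ⊢ ι m ⌢[ k ] w →
                      ∃[ m′ ] (ι m′ ≡ w × Ev (λ n → T (C.P n) ⊢ ι m ⌢[ k ] w))
            TP-walk zero      refl        = _ , refl , ev-map 𝓕 (λ _ → refl) (ev-≥ 𝓕 0)
            TP-walk (ℕ.suc k) (w , a , p)
              with proj₁ (proj₁ (T-vertices P∞) (proj₂ (⌢-vertices (T P∞) a)))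
            ... | m₁ , refl with TP-walk k p
            ...   | m′ , e , q =
              m′ , e , ev-map 𝓕 (λ (h , p) → w , ⌢-mono (proj₁ h) a , p) (ev-× 𝓕 (TP-agree _) q)

            -- Some `n` of at least `k` has this walk, and there `T` of both graphs agrees at `w`
            -- with `T` of the limits; `near` reaches `w`. As `k` is arbitrary, this covers the
            -- whole component.
            T-limits-agree : ∀ k {w} → T P∞ ⊢ ι 0 ⌢[ k ] w → Agree (T P∞) (T Q∞) w
            T-limits-agree k p with TP-walk k p
            ... | m , refl , ev =
              let n , (q , k≤n) , hP , hQ =
                    ev-∃ 𝓕 (ev-× 𝓕 (ev-× 𝓕 ev (ev-≥ 𝓕 k)) (ev-× 𝓕 (TP-agree m) (TQ-agree m)))
              in agree-trans hP (agree-trans (C.near n k≤n q) (agree-sym hQ))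

            limits-agree : Agree P∞ Q∞ (ι 0)
            limits-agree = agree-trans (≈⇒agree (≈-sym (T⁻¹∘T P∞)))
              (agree-trans (T⁻¹-component (T P∞) (T Q∞) T-limits-agree) (≈⇒agree (T⁻¹∘T Q∞)))

          decided-absurd : ⊥
          decided-absurd =
            let n , hP , hQ = ev-∃ 𝓕 (ev-× 𝓕 (BP.limit-agree 0) (BQ.limit-agree 0))
            in C.distinct n (agree-trans (agree-sym hP) (agree-trans limits-agree hQ))

      no-normal-counterexamples : ¬ (∀ n → NormalCounterexample ι n)
      no-normal-counterexamples c = decided-absurd c 𝓕 (decided ∘ inj₁) (decided ∘ inj₂)
        where
        Holds : Fact ℕ ⊎ Fact ℕ → Pred ℕ 0ℓ
        Holds (inj₁ φ) n = NormalCounterexample.P (c n) ⊨ map-fact ι φ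
        Holds (inj₂ φ) n = NormalCounterexample.Q (c n) ⊨ map-fact ι φ

        code : Fact ℕ → ℕ
        code = code-fact (code-finite Σ-finite) (code-finite Δ-finite)

        code-injective : Injective _≡_ _≡_ code
        code-injective = code-fact-injective _ _ (code-finite-injective Σ-finite) (code-finite-injective Δ-finite)

        deciding = deciding-filter (code-⊎ code code) (code-⊎-injective code-injective code-injective) Holds
        𝓕        = proj₁ deciding
        decided  = proj₂ deciding

    -- The centres and vertices of all the counterexamples form a countable set, so one sequence of
    -- fresh names normalises all of them at once.
    no-counterexamples : ¬ (∀ n → Counterexample n)
    no-counterexamples c =
      no-normal-counterexamples ι-injective
        (λ n → normalise ι-injective (c n) (λ m x → ι-avoids m (n , x)))
      where
      module C n = Counterexample (c n)
      open Fresh uncountable (countable-⋃ λ n → countable-∪ {P = ｛ C.v n ｝} (countable-｛｝ _)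
        (countable-∪ (countable (C.P n)) (countable (C.Q n))))

    T⁻¹-local : ∃[ n ] (∀ {G H v} → AgreeBall n G H v → Agree (T⁻¹ G) (T⁻¹ H) v)
    T⁻¹-local = map₂ locality (decidable-stable em λ ∄ →
      no-counterexamples λ n → decidable-stable em λ ¬c → ∄ (n , ¬c))
      where
      locality : ∀ {n} → ¬ Counterexample n → ∀ {G H v} → AgreeBall n G H v → Agree (T⁻¹ G) (T⁻¹ H) v
      locality ¬c {G} {H} b = decidable-stable em₀ λ ¬a → ¬c record
        { v        = _
        ; P        = T⁻¹ G
        ; Q        = T⁻¹ H
        ; near     = λ le p → agree-trans (≈⇒agree (T∘T⁻¹ G)) (agree-trans
                       (b le (ball-walk (≈⇒ball (T∘T⁻¹ G)) _ le p)) (≈⇒agree (≈-sym (T∘T⁻¹ H))))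
        ; distinct = ¬a
        }

  -- From dynamics to vertex-preserving bijections

  singleton : V → Graph
  singleton v = record
    { vertices     = ｛ v ｝
    ; countable    = countable-｛｝ v
    ; σ            = λ _ → ⊥
    ; σ-dom        = λ ()
    ; σ-functional = λ ()
    ; δ            = λ _ → ⊥
    ; δ-dom        = λ ()
    ; δ-functional = λ ()
    ; δ-onceˡ      = λ ()
    ; δ-onceʳ      = λ ()
    ; δ-onceˡʳ     = λ ()
    }

  -- Take the family of all graphs whose image contains `v′`. The images have `v′` in common, so by
  -- `no-creation` the graphs have a common vertex.
  antecedent : (F : Dynamics) → ∀ v′ → ∃[ v ] (v ∈ antecedents F v′)
  antecedent F v′ = decidable-stable em λ ∄ →
    Dynamics.no-creation F {I = ∃[ G ] (v′ ∈ vertices (F · G))} proj₁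
      (λ v h → ∄ (v , λ G x → h (G , x))) v′ proj₂

  module VertexBijection (Σ-finite : Finite Σ) (Δ-finite : Finite Δ) (F F† : Dynamics)
    (F†F : ∀ G → F† · F · G ≈ G) (FF† : ∀ G → F · F† · G ≈ G)
    (φ : V ↔ V)
    (φ-∈   : ∀ G {v} → v ∈ vertices G → Inverse.to φ v ∈ vertices (F · G))
    (φ-∈⁻¹ : ∀ G {v} → Inverse.to φ v ∈ vertices (F · G) → v ∈ vertices G)
    where

    open Inverse φ using (strictlyInverseˡ; strictlyInverseʳ) renaming (to to φ·; from to φ⁻¹·)

    φ⁻¹ : V ↔ V
    φ⁻¹ = ↔-sym φ

    T T⁻¹ : Graph → Graph
    T G   = rename φ⁻¹ (F · G)
    T⁻¹ K = F† · rename φ K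

    T∘T⁻¹ : ∀ K → T (T⁻¹ K) ≈ K
    T∘T⁻¹ K = ≈-trans (rename-cong φ⁻¹ (FF† (rename φ K))) (rename-inverse φ⁻¹ φ K strictlyInverseʳ)

    T⁻¹∘rename : ∀ G → T⁻¹ (rename φ⁻¹ G) ≈ F† · G
    T⁻¹∘rename G = Dynamics.apply-cong F† (rename-inverse φ φ⁻¹ G strictlyInverseˡ)

    T⁻¹∘T : ∀ G → T⁻¹ (T G) ≈ G
    T⁻¹∘T G = ≈-trans (T⁻¹∘rename (F · G)) (F†F G)

    -- Tested on the graph `u` whose only vertex is the preimage of `v` under `R`: the preimage of
    -- `φ· v` under `R′` lies in `F · u`, and `φ` allows only one point there.
    conjugate : ∀ R R′ → (∀ G → F · rename R G ≈ rename R′ (F · G)) →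
                ∀ v → Inverse.from R′ (φ· v) ≡ φ· (Inverse.from R v)
    conjugate R R′ F-rename v =
      trans (sym (strictlyInverseˡ _)) (cong φ· (sym (φ-∈⁻¹ u
        (subst (_∈ vertices (F · u)) (sym (strictlyInverseˡ _))
          (proj₁ (vertices-≐ (F-rename u)) (φ-∈ (rename R u) refl))))))
      where u = singleton (Inverse.from R v)

    T-rename : ∀ R G → T (rename R G) ≈ rename R (T G)
    T-rename R G =
      let R′ , F-rename = Dynamics.renaming-compatible F R
      in ≈-trans (rename-cong φ⁻¹ (F-rename G))
           (rename-swap φ⁻¹ R′ R φ⁻¹ (F · G) (conjugate R R′ F-rename))

    -- On the graph `K` with sole vertex `φ· v`, the image `F† · K` contains `v`, so an antecedent
    -- of `v` has to be that sole vertex. Hence each `w` has at most one `v` to count, and the bound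
    -- is 1.
    antecedents-F† : ∀ {v w} → w ∈ antecedents F† v → φ· v ≡ w
    antecedents-F† {v} a = a K (φ-∈⁻¹ (F† · K) (proj₂ (vertices-≐ (FF† K)) refl))
      where K = singleton (φ· v)

    F†-bounded : ∀ G {w} → w ∈ vertices G →
                 (λ v → v ∈ vertices (F† · G) × w ∈ antecedents F† v) ≼ Fin 1
    F†-bounded G _ = (λ _ → Fin.zero) , λ {v} {v′} (_ , p) (_ , q) _ →
      trans (sym (strictlyInverseʳ v))
        (trans (cong φ⁻¹· (trans (antecedents-F† p) (sym (antecedents-F† q)))) (strictlyInverseʳ v′))

    T⁻¹-local⇒causal : ∀ {n} → (∀ {G H v} → AgreeBall n G H v → Agree (T⁻¹ G) (T⁻¹ H) v) → Causal F†
    T⁻¹-local⇒causal {n} T⁻¹-local = n , 1 , record { local = local ; bounded = F†-bounded }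
      where
      local : ∀ v′ {v} → v ∈ antecedents F† v′ → ∀ G H →
              envelope G n ｛ v ｝ ≈• envelope H n ｛ v ｝ → star (F† · G) v′ ≈ star (F† · H) v′
      local v′ a G H e with antecedents-F† a
      -- Renaming by `φ⁻¹` moves the ball around `φ· v′` to `v′`, where `T⁻¹` is local.
      ... | refl = agree⇒star (agree-trans (≈⇒agree (≈-sym (T⁻¹∘rename G))) (agree-trans
        (T⁻¹-local (rename-ball φ⁻¹ (envelope⇒ball e))) (≈⇒agree (T⁻¹∘rename H))))

    F†-causal : Causal F → Causal F†
    F†-causal (r , b , F-causal) = T⁻¹-local⇒causal
      (proj₂ (Bijection.T⁻¹-local Σ-finite Δ-finite T T⁻¹
        (λ e → Dynamics.apply-cong F† (rename-cong φ e)) T∘T⁻¹ T⁻¹∘T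
        (λ G → φ-∈⁻¹ G , φ-∈ G) T-rename r T-local))
      where
      T-local : ∀ {G H v} → AgreeBall r G H v → Agree (T G) (T H) v
      T-local {G} {H} {v} ball = rename-agree φ⁻¹ (star⇒agree
        -- By `φ-∈⁻¹`, `v` is an antecedent of `φ· v`, so causality of `F` applies with the ball
        -- around `v`.
        (CausalWith.local F-causal (φ· v) (λ K → φ-∈⁻¹ K) G H (ball⇒envelope ball)))

  module _ (F F† : Dynamics) (inverse : F† IsInverseOf F) where

    private
      F†F = proj₁ inverse
      FF† = proj₂ inverse

      desc anc : V → V
      desc v = proj₁ (antecedent F† v)
      anc  w = proj₁ (antecedent F w)

      -- Since `v` is in `F† · F · G`, its antecedent under `F†` is in `F · G`.
      desc-∈ : ∀ G {v} → v ∈ vertices G → desc v ∈ vertices (F · G)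
      desc-∈ G {v} v∈ = proj₂ (antecedent F† v) (F · G) (proj₂ (vertices-≐ (F†F G)) v∈)

      anc-∈ : ∀ G {w} → w ∈ vertices (F · G) → anc w ∈ vertices G
      anc-∈ G {w} = proj₂ (antecedent F w) G

      -- In `singleton v` the antecedent of `desc v` can only be `v`; `desc-anc` uses `singleton w`
      -- as an image of `F` in the same way.
      anc-desc : ∀ v → anc (desc v) ≡ v
      anc-desc v = sym (anc-∈ (singleton v) (desc-∈ (singleton v) refl))

      desc-anc : ∀ w → desc (anc w) ≡ w
      desc-anc w = sym (proj₂ (antecedent F† (anc w)) (singleton w)
        (anc-∈ (F† · singleton w) (proj₂ (vertices-≐ (FF† (singleton w))) refl)))

    inverse-causal : Finite Σ → Finite Δ → Causal F → Causal F†
    inverse-causal Σ-finite Δ-finite =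
      VertexBijection.F†-causal Σ-finite Δ-finite F F† F†F FF†
        (mk↔ₛ′ desc anc desc-anc anc-desc) desc-∈
        (λ G x → subst (_∈ vertices G) (anc-desc _) (anc-∈ G x))

theorem4 : ExcludedMiddle (suc 0ℓ) →
    (V Σ Δ : Set) (π : ℕ) → Uncountable V → Finite Σ → Finite Δ →
    let open GraphDynamics V Σ Δ π in
    (F F† : Dynamics) → Causal F → F† IsInverseOf F → Causal F†
theorem4 em V Σ Δ π uncountable Σ-finite Δ-finite F F† F-causal inverse =
  Causality.inverse-causal em V Σ Δ π uncountable F F† inverse Σ-finite Δ-finite F-causal
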